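{- Let $D=(E,\mathcal F)$ be a proper set system. Then there exists a feasible set $F\in\mathcal F$ such that $$\omega(D^{\ast\times\ast|F})=\max_{B\subseteq E}\omega(D^{\ast\times\ast|B}).$$
   Context: A set system is a pair $D=(E,\mathcal F)$ with $E$ a finite set and $\mathcal F\subseteq 2^E$; the members of $\mathcal F$ are the feasible sets of $D$, also denoted $\mathcal F(D)$. $D$ is proper if $\mathcal F\neq\emptyset$. For proper $D$, $r(D_{\max})$ and $r(D_{\min})$ denote the largest and smallest cardinality of a feasible set, and the width is $\omega(D)=r(D_{\max})-r(D_{\min})$. Twist: for $A\subseteq E$, $D^{\ast|A}=(E,\{F\triangle A\mid F\in\mathcal F\})$, where $\triangle$ is symmetric difference. Loop complementation: for $e\in E$, $D^{\times|e}=(E,\mathcal F')$ with $\mathcal F'=\mathcal F\,\triangle\,\{F\cup\{e\}\mid F\in\mathcal F,\ e\notin F\}$. Loop complementations on distinct elements commute, and for $A\subseteq E$, $D^{\times|A}$ is obtained by applying loop complementation to every element of $A$. These operations preserve properness. Words are read left to right: $D^{\ast\times\ast|A}=((D^{\ast|A})^{\times|A})^{\ast|A}$. -}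

module Defs where

open import Data.Bool.Properties using () renaming (_≟_ to _≟ᵇ_)
open import Data.Fin using (Fin)
open import Data.Fin.Subset using (Subset; inside; outside; _∉_; _∪_; _─_; ⁅_⁆; ∣_∣)
open import Data.Fin.Subset.Properties using (_∈?_; anySubset?)
open import Data.List using (List; []; _∷_; _++_; map; filter; foldl; allFin)
open import Data.List.Extrema.Nat using (max; min)
open import Data.Nat using (ℕ; zero; suc; _∸_)
open import Data.Product using (∃; _×_)
open import Data.Vec using ([]; _∷_)
open import Data.Vec.Properties using (≡-dec)
open import Level using (0ℓ)
open import Relation.Binary.Definitions using (DecidableEquality)
open import Relation.Binary.PropositionalEquality using (_≡_)
open import Relation.Nullary.Decidable using (_×-dec_; _⊎-dec_; ¬?)
open import Relation.Unary as Pred using (Pred; Decidable; Satisfiable)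

private
  variable
    n : ℕ

-- The ground set is E = Fin n.  Decidability of membership in the family
-- expresses that the family is a genuine element of 2^(2^E), and is what
-- lets the largest and smallest cardinalities be computed.
record SetSystem (n : ℕ) : Set₁ where
  field
    Feasible  : Pred (Subset n) 0ℓ
    feasible? : Decidable Feasible

open SetSystem public

Proper : SetSystem n → Set
Proper D = Satisfiable (Feasible D)

infixl 6 _△_

_△_ : Subset n → Subset n → Subset n
A △ B = (A ─ B) ∪ (B ─ A)

_≟ˢ_ : DecidableEquality (Subset n)
_≟ˢ_ = ≡-dec _≟ᵇ_

allSubsets : (n : ℕ) → List (Subset n)
allSubsets zero    = [] ∷ []
allSubsets (suc n) =
  map (outside ∷_) (allSubsets n) ++ map (inside ∷_) (allSubsets n)

cardinalities : SetSystem n → List ℕ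
cardinalities {n} D = map ∣_∣ (filter (feasible? D) (allSubsets n))

-- Every cardinality lies between 0 and n, so for proper D the default
-- arguments of max and min do not affect the result, and these are r(D_max)
-- and r(D_min).  On a non-proper D the values carry no meaning.
rmax : SetSystem n → ℕ
rmax D = max 0 (cardinalities D)

rmin : SetSystem n → ℕ
rmin {n} D = min n (cardinalities D)

-- Truncated subtraction is exact for proper D, where rmin D ≤ rmax D.
ω : SetSystem n → ℕ
ω D = rmax D ∸ rmin D

infixl 7 _*∣_ _×∣₁_ _×∣_ _*×*∣_

_*∣_ : SetSystem n → Subset n → SetSystem n
Feasible  (D *∣ A) X = ∃ λ F → Feasible D F × X ≡ F △ A
feasible? (D *∣ A) X = anySubset? λ F → feasible? D F ×-dec (X ≟ˢ (F △ A))

Adjoin : SetSystem n → Fin n → Pred (Subset n) 0ℓ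
Adjoin D e X = ∃ λ F → Feasible D F × e ∉ F × X ≡ F ∪ ⁅ e ⁆

adjoin? : (D : SetSystem n) (e : Fin n) → Decidable (Adjoin D e)
adjoin? D e X = anySubset? λ F →
  feasible? D F ×-dec (¬? (e ∈? F) ×-dec (X ≟ˢ (F ∪ ⁅ e ⁆)))

-- 𝓕 △ { F ∪ {e} ∣ F ∈ 𝓕 , e ∉ F }, with △ at the level of families.
_×∣₁_ : SetSystem n → Fin n → SetSystem n
Feasible  (D ×∣₁ e) = (Feasible D Pred.∖ Adjoin D e) Pred.∪ (Adjoin D e Pred.∖ Feasible D)
feasible? (D ×∣₁ e) X =
  (feasible? D X ×-dec ¬? (adjoin? D e X)) ⊎-dec
  (adjoin? D e X ×-dec ¬? (feasible? D X))

-- Loop complementation on A, applied to the elements of A in increasing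
-- order; the order is immaterial because they commute.
_×∣_ : SetSystem n → Subset n → SetSystem n
_×∣_ {n} D A = foldl _×∣₁_ D (filter (_∈? A) (allFin n))

_*×*∣_ : SetSystem n → Subset n → SetSystem n
D *×*∣ A = ((D *∣ A) ×∣ A) *∣ A

-- The maximum of f over all subsets; the base value 0 is harmless since
-- f is ℕ-valued and allSubsets n is nonempty.
maxSubsets : (Subset n → ℕ) → ℕ
maxSubsets {n} f = max 0 (map f (allSubsets n))

{-# OPTIONS --safe #-}

-- Unfolding the definitions, X is feasible in D *×*∣ B iff an odd number of
-- feasible Z satisfy X ⊆ Z ⊆ X ∪ B.  Hence every feasible set of D *×*∣ B lies
-- inside a feasible set of D, so ω (D *×*∣ B) ≤ rmax D for all B.  A feasible set
-- of maximum cardinality is the only Z for X = Z, so it survives in D *×*∣ B, and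
-- if F is feasible of minimum cardinality then it is the only Z for X = ∅ and
-- B = F, so ∅ is feasible in D *×*∣ F.  Therefore ω (D *×*∣ F) = rmax D.  Only the
-- cases of zero and of exactly one such Z matter, so parities are not needed.
module Submission where

open import Defs
open import Data.Bool using (true; false)
open import Data.Fin using (Fin)
open import Data.Fin.Subset
  using (Subset; outside; _∈_; _∉_; _⊆_; _∪_; _─_; ⁅_⁆; ∣_∣; ⊥)
open import Data.Fin.Subset.Properties
  using (_∈?_; x∈⁅x⁆; x∈⁅y⁆⇒x≡y; ⊆-antisym; p⊂q⇒∣p∣<∣q∣; x∈p∪q⁻; x∈p∪q⁺;
         x∈p∧x∉q⇒x∈p─q; p─q⊆p; ∉⊥; ⊥⊆; ∣⊥∣≡0;
         p⊆q⇒∣p∣≤∣q∣)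
open import Data.List using (List; []; _∷_; map; filter; foldl; allFin)
open import Data.List.Extrema.Nat
  using (argmin; argmin-all; f[argmin]≤f[xs]; argmax; argmax-all; f[xs]≤f[argmax];
         max≤v⁺; xs≤max; min≤xs)
open import Data.List.Membership.Propositional using () renaming (_∈_ to _∈ˡ_)
open import Data.List.Membership.Propositional.Properties
  using (∈-++⁺ˡ; ∈-++⁺ʳ; ∈-map⁺; ∈-filter⁺; ∈-filter⁻; ∈-allFin)
open import Data.List.Relation.Unary.All as All using ()
open import Data.List.Relation.Unary.All.Properties using (map⁺; all-filter)
open import Data.List.Relation.Unary.AllPairs using (_∷_)
open import Data.List.Relation.Unary.Any using (here; there)
open import Data.List.Relation.Unary.Unique.Propositional using (Unique)
import Data.List.Relation.Unary.Unique.Propositional.Properties as Unique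
open import Data.Nat using (ℕ; suc; _≤_; z≤n)
open import Data.Nat.Properties
  using (≤-trans; ≤-reflexive; ≤-antisym; ≤⇒≯; m∸n≤m; ∸-mono; module ≤-Reasoning)
open import Data.Product using (∃; _×_; _,_; proj₁; proj₂)
open import Data.Sum using (_⊎_; inj₁; inj₂; [_,_]′; map₂)
open import Data.Vec using ([]; _∷_; here; there)
open import Function using (_∘_; id)
open import Level using (0ℓ)
open import Relation.Binary.PropositionalEquality
  using (_≡_; refl; sym; cong; subst)
open import Relation.Nullary using (¬_; yes; no; contradiction)
open import Relation.Unary using (Pred)

private
  variable
    n : ℕ
    x e : Fin n
    A B X Y Z : Subset n
    P Q : Pred (Fin n) 0ℓ
    D : SetSystem n

-- Symmetric difference and comparison by cardinality.

x∈p─q⇒x∉q : ∀ (p q : Subset n) → x ∈ p ─ q → x ∉ q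
x∈p─q⇒x∉q (_ ∷ p) (_ ∷ q) (there i) (there j) = x∈p─q⇒x∉q p q i j
x∈p─q⇒x∉q (_ ∷ p) (.true ∷ q) () here

x∈p△q⁻ : x ∈ X △ Y → (x ∈ X × x ∉ Y) ⊎ (x ∈ Y × x ∉ X)
x∈p△q⁻ {X = X} {Y} i with x∈p∪q⁻ (X ─ Y) (Y ─ X) i
... | inj₁ j = inj₁ (p─q⊆p X Y j , x∈p─q⇒x∉q X Y j)
... | inj₂ j = inj₂ (p─q⊆p Y X j , x∈p─q⇒x∉q Y X j)

x∈p∧x∉q⇒x∈p△q : x ∈ X → x ∉ Y → x ∈ X △ Y
x∈p∧x∉q⇒x∈p△q i j = x∈p∪q⁺ (inj₁ (x∈p∧x∉q⇒x∈p─q i j))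

x∉p∧x∈q⇒x∈p△q : x ∉ X → x ∈ Y → x ∈ X △ Y
x∉p∧x∈q⇒x∈p△q i j = x∈p∪q⁺ (inj₂ (x∈p∧x∉q⇒x∈p─q j i))

△-involutive : (X A : Subset n) → (X △ A) △ A ≡ X
△-involutive []          []          = refl
△-involutive (true  ∷ X) (true  ∷ A) = cong (true  ∷_) (△-involutive X A)
△-involutive (true  ∷ X) (false ∷ A) = cong (true  ∷_) (△-involutive X A)
△-involutive (false ∷ X) (true  ∷ A) = cong (false ∷_) (△-involutive X A)
△-involutive (false ∷ X) (false ∷ A) = cong (false ∷_) (△-involutive X A)

⊆∧∣∣≥⇒≡ : X ⊆ Y → ∣ Y ∣ ≤ ∣ X ∣ → X ≡ Y
⊆∧∣∣≥⇒≡ {X = X} X⊆Y ∣Y∣≤∣X∣ = ⊆-antisym X⊆Y Y⊆X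
  where
  Y⊆X : _ ⊆ X
  Y⊆X {x} x∈Y with x ∈? X
  ... | yes x∈X = x∈X
  ... | no  x∉X = contradiction (p⊂q⇒∣p∣<∣q∣ (X⊆Y , x , x∈Y , x∉X)) (≤⇒≯ ∣Y∣≤∣X∣)

-- Twists and the interval condition.

*∣-feasible⁻ : Feasible (D *∣ A) X → Feasible D (X △ A)
*∣-feasible⁻ {D = D} {A} (F , F∈D , refl) =
  subst (Feasible D) (sym (△-involutive F A)) F∈D

*∣-feasible⁺ : Feasible D (X △ A) → Feasible (D *∣ A) X
*∣-feasible⁺ {X = X} {A} i = X △ A , i , sym (△-involutive X A)

-- `P` is a predicate so that it can be membership in a subset, as twists require, or in the list of
-- elements still to be complemented, as induction on the fold requires.
Between : Pred (Fin n) 0ℓ → Subset n → Subset n → Set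
Between P Y X = Y ⊆ X × (∀ {x} → x ∈ X → x ∈ Y ⊎ P x)

Between-mono : (∀ {x} → P x → Q x) → Between P Y X → Between Q Y X
Between-mono P⊆Q (Y⊆X , X⊆) = Y⊆X , map₂ P⊆Q ∘ X⊆

-- The hypothesis says that `X` and `Y` agree outside `B` and are disjoint inside `B`. Both
-- conditions are symmetric in `X` and `Y`.
Between-△ : Between (_∈ B) Y (X △ B) → Between (_∈ B) X (Y △ B)
Between-△ {B = B} {Y} {X} (Y⊆ , ⊆Y∪B) = X⊆ , ⊆X∪B
  where
  X⊆ : X ⊆ Y △ B
  X⊆ {x} x∈X with x ∈? B
  ... | yes x∈B = x∉p∧x∈q⇒x∈p△q
    ([ (λ (_ , x∉B) → x∉B x∈B) , (λ (_ , x∉X) → x∉X x∈X) ]′ ∘ x∈p△q⁻ ∘ Y⊆) x∈B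
  ... | no x∉B with ⊆Y∪B (x∈p∧x∉q⇒x∈p△q x∈X x∉B)
  ...   | inj₁ x∈Y = x∈p∧x∉q⇒x∈p△q x∈Y x∉B
  ...   | inj₂ x∈B = contradiction x∈B x∉B
  ⊆X∪B : ∀ {x} → x ∈ Y △ B → x ∈ X ⊎ x ∈ B
  ⊆X∪B i with x∈p△q⁻ i
  ... | inj₂ (x∈B , _) = inj₂ x∈B
  ... | inj₁ (x∈Y , x∉B) with x∈p△q⁻ (Y⊆ x∈Y)
  ...   | inj₁ (x∈X , _) = inj₁ x∈X
  ...   | inj₂ (x∈B , _) = inj₂ x∈B

-- A special case of an odd number of candidates that each loop complementation passes on to the
-- next.
UniqueBetween : SetSystem n → Pred (Fin n) 0ℓ → Subset n → Subset n → Set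
UniqueBetween D P X Y = Feasible D Y × Between P Y X ×
  (∀ {Y′} → Feasible D Y′ → Between P Y′ X → Y′ ≡ Y)

-- Loop complementation along a list.

Y⊆Y∪⁅e⁆ : Y ⊆ Y ∪ ⁅ e ⁆
Y⊆Y∪⁅e⁆ = x∈p∪q⁺ ∘ inj₁

e∈Y∪⁅e⁆ : e ∈ Y ∪ ⁅ e ⁆
e∈Y∪⁅e⁆ {e = e} = x∈p∪q⁺ (inj₂ (x∈⁅x⁆ e))

Between-∪⁻ : {L : List (Fin n)} →
  Between (_∈ˡ L) (Y ∪ ⁅ e ⁆) X → Between (_∈ˡ e ∷ L) Y X
Between-∪⁻ {Y = Y} {e} (Y∪e⊆X , X⊆) = Y∪e⊆X ∘ Y⊆Y∪⁅e⁆ , split ∘ X⊆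
  where
  split : ∀ {x L} → x ∈ Y ∪ ⁅ e ⁆ ⊎ x ∈ˡ L → x ∈ Y ⊎ x ∈ˡ e ∷ L
  split (inj₂ x∈L) = inj₂ (there x∈L)
  split (inj₁ i) with x∈p∪q⁻ Y ⁅ e ⁆ i
  ... | inj₁ x∈Y = inj₁ x∈Y
  ... | inj₂ j   = inj₂ (here (x∈⁅y⁆⇒x≡y e j))

-- Undoing one complementation keeps the set or removes `e`, which the longer list permits. The fold
-- treats its head first, so the induction hypothesis concerns `D ×∣₁ e`.
×∣-list-feasible⁻ : (L : List (Fin n)) → Feasible (foldl _×∣₁_ D L) X →
  ∃ λ Y → Feasible D Y × Between (_∈ˡ L) Y X
×∣-list-feasible⁻ []      X∈D = _ , X∈D , id , inj₁
×∣-list-feasible⁻ {D = D} (e ∷ L) X∈D′ with ×∣-list-feasible⁻ {D = D ×∣₁ e} L X∈D′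
... | Y , inj₁ (Y∈D , _) , btw = Y , Y∈D , Between-mono there btw
... | _ , inj₂ ((F , F∈D , _ , refl) , _) , btw = F , F∈D , Between-∪⁻ btw

-- Every candidate for `D ×∣₁ e` arises from a candidate for `D`, hence from `Y`, by keeping it or
-- adjoining `e`. Cancellation would require two candidates for `D`, one with `e` and one without.
×∣₁-unique : {L : List (Fin n)} → ¬ (e ∈ˡ L) →
  UniqueBetween D (_∈ˡ e ∷ L) X Y → ∃ (UniqueBetween (D ×∣₁ e) (_∈ˡ L) X)
×∣₁-unique {e = e} {D} {X} {Y} {L} e∉L (Y∈D , (Y⊆X , X⊆) , unique)
  with e ∈? Y | e ∈? X
-- `Y` persists: a set `F` cancelling it, or yielding another candidate `F ∪ ⁅ e ⁆`, would be a
-- second candidate for `D`, lacking `e`.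
... | yes e∈Y | _ =
  Y , inj₁ (Y∈D , λ { (F , F∈D , e∉F , refl) → ¬adjoin F∈D e∉F (Y⊆X , X⊆Y∪L) })
    , (Y⊆X , X⊆Y∪L) , unique′
  where
  ¬adjoin : ∀ {F} → Feasible D F → e ∉ F → ¬ Between (_∈ˡ L) (F ∪ ⁅ e ⁆) X
  ¬adjoin F∈D e∉F btw =
    e∉F (subst (e ∈_) (sym (unique F∈D (Between-∪⁻ btw))) e∈Y)
  X⊆Y∪L : ∀ {x} → x ∈ X → x ∈ Y ⊎ x ∈ˡ L
  X⊆Y∪L x∈X with X⊆ x∈X
  ... | inj₁ x∈Y          = inj₁ x∈Y
  ... | inj₂ (here refl)  = inj₁ e∈Y
  ... | inj₂ (there x∈L)  = inj₂ x∈L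
  unique′ : ∀ {Y′} → Feasible (D ×∣₁ e) Y′ → Between (_∈ˡ L) Y′ X → Y′ ≡ Y
  unique′ (inj₁ (Y′∈D , _)) btw = unique Y′∈D (Between-mono there btw)
  unique′ (inj₂ ((F , F∈D , e∉F , refl) , _)) btw = contradiction btw (¬adjoin F∈D e∉F)
-- Here the candidate must contain `e`, so `Y` is replaced by `Y ∪ ⁅ e ⁆`.
... | no e∉Y | yes e∈X =
  Y ∪ ⁅ e ⁆
    , inj₂ ((Y , Y∈D , e∉Y , refl) , λ Y∪e∈D → ¬feasible Y∪e∈D btw∪ e∈Y∪⁅e⁆)
    , btw∪ , unique′
  where
  ¬feasible : ∀ {Y′} → Feasible D Y′ → Between (_∈ˡ L) Y′ X → e ∉ Y′
  ¬feasible Y′∈D btw e∈Y′ =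
    e∉Y (subst (e ∈_) (unique Y′∈D (Between-mono there btw)) e∈Y′)
  Y∪e⊆X : Y ∪ ⁅ e ⁆ ⊆ X
  Y∪e⊆X i with x∈p∪q⁻ Y ⁅ e ⁆ i
  ... | inj₁ x∈Y = Y⊆X x∈Y
  ... | inj₂ j   = subst (_∈ X) (sym (x∈⁅y⁆⇒x≡y e j)) e∈X
  X⊆Y∪e∪L : ∀ {x} → x ∈ X → x ∈ Y ∪ ⁅ e ⁆ ⊎ x ∈ˡ L
  X⊆Y∪e∪L x∈X with X⊆ x∈X
  ... | inj₁ x∈Y         = inj₁ (Y⊆Y∪⁅e⁆ x∈Y)
  ... | inj₂ (here refl) = inj₁ e∈Y∪⁅e⁆
  ... | inj₂ (there x∈L) = inj₂ x∈L
  btw∪ : Between (_∈ˡ L) (Y ∪ ⁅ e ⁆) X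
  btw∪ = Y∪e⊆X , X⊆Y∪e∪L
  unique′ : ∀ {Y′} → Feasible (D ×∣₁ e) Y′ → Between (_∈ˡ L) Y′ X → Y′ ≡ Y ∪ ⁅ e ⁆
  -- As `e` is in `X` but not in `L`, the interval forces it into `Y′`, against `¬feasible`.
  unique′ (inj₁ (Y′∈D , _)) btw with proj₂ btw e∈X
  ... | inj₁ e∈Y′ = contradiction e∈Y′ (¬feasible Y′∈D btw)
  ... | inj₂ e∈L  = contradiction e∈L e∉L
  unique′ (inj₂ ((F , F∈D , _ , refl) , _)) btw =
    cong (_∪ ⁅ e ⁆) (unique F∈D (Between-∪⁻ btw))
-- `Y` persists, and no set with `e` adjoined fits inside `X`.
... | no e∉Y | no e∉X =
  Y , inj₁ (Y∈D , λ { (F , _ , _ , refl) → e∉Y e∈Y∪⁅e⁆ })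
    , (Y⊆X , X⊆Y∪L) , unique′
  where
  X⊆Y∪L : ∀ {x} → x ∈ X → x ∈ Y ⊎ x ∈ˡ L
  X⊆Y∪L x∈X with X⊆ x∈X
  ... | inj₁ x∈Y         = inj₁ x∈Y
  ... | inj₂ (here refl) = contradiction x∈X e∉X
  ... | inj₂ (there x∈L) = inj₂ x∈L
  unique′ : ∀ {Y′} → Feasible (D ×∣₁ e) Y′ → Between (_∈ˡ L) Y′ X → Y′ ≡ Y
  unique′ (inj₁ (Y′∈D , _)) btw = unique Y′∈D (Between-mono there btw)
  unique′ (inj₂ ((F , _ , _ , refl) , _)) (F∪e⊆X , _) =
    contradiction (F∪e⊆X e∈Y∪⁅e⁆) e∉X

-- Once the list is exhausted the interval has collapsed, so the remaining candidate is `X`. At each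
-- step `Unique` keeps the head out of the tail.
×∣-list-feasible⁺ : {L : List (Fin n)} → Unique L →
  UniqueBetween D (_∈ˡ L) X Y → Feasible (foldl _×∣₁_ D L) X
×∣-list-feasible⁺ {D = D} {L = []} _ (Y∈D , (Y⊆X , X⊆) , _) =
  subst (Feasible D) (⊆-antisym Y⊆X ([ id , (λ ()) ]′ ∘ X⊆)) Y∈D
×∣-list-feasible⁺ {D = D} {L = e ∷ L} (e≢L ∷ uniqueL) uniqueY =
  ×∣-list-feasible⁺ {D = D ×∣₁ e} uniqueL
    (proj₂ (×∣₁-unique {D = D} (λ e∈L → All.lookup e≢L e∈L refl) uniqueY))

-- Feasible sets of `D *×*∣ B`.

elements : Subset n → List (Fin n)
elements {n} A = filter (_∈? A) (allFin n)

∈-elements⁺ : x ∈ A → x ∈ˡ elements A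
∈-elements⁺ {x = x} {A} = ∈-filter⁺ (_∈? A) (∈-allFin x)

∈-elements⁻ : x ∈ˡ elements A → x ∈ A
∈-elements⁻ {n} {A = A} i = proj₂ (∈-filter⁻ (_∈? A) {xs = allFin n} i)

*×*∣-feasible⁻ : Feasible (D *×*∣ B) X → ∃ λ Z → Feasible D Z × X ⊆ Z
*×*∣-feasible⁻ {D = D} {B} {X} X∈D′
  with ×∣-list-feasible⁻ {D = D *∣ B} (elements B)
         (*∣-feasible⁻ {D = (D *∣ B) ×∣ B} X∈D′)
... | Y , Y∈D*B , btw =
  Y △ B , *∣-feasible⁻ {D = D} Y∈D*B , proj₁ (Between-△ (Between-mono ∈-elements⁻ btw))

-- Through `Between-△`, the candidates `Z` above `X` correspond to the candidates `Z △ B` of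
-- `D *∣ B` below `X △ B`, so uniqueness carries over.
*×*∣-feasible⁺ : Feasible D Z → Between (_∈ B) X Z →
  (∀ {Z′} → Feasible D Z′ → Between (_∈ B) X Z′ → Z′ ≡ Z) → Feasible (D *×*∣ B) X
*×*∣-feasible⁺ {D = D} {Z} {B} {X} Z∈D btw unique =
  *∣-feasible⁺ {D = (D *∣ B) ×∣ B}
    (×∣-list-feasible⁺ {D = D *∣ B} {Y = Z △ B} (Unique.filter⁺ (_∈? B) (Unique.allFin⁺ _))
      ( (Z , Z∈D , refl)
      , Between-mono ∈-elements⁺
          (Between-△ (subst (Between (_∈ B) X) (sym (△-involutive Z B)) btw))
      , unique′))
  where
  unique′ : ∀ {Y} → Feasible (D *∣ B) Y → Between (_∈ˡ elements B) Y (X △ B) → Y ≡ Z △ B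
  unique′ (F , F∈D , refl) btw′ = cong (_△ B) (unique F∈D
    (subst (Between (_∈ B) X) (△-involutive F B)
      (Between-△ (Between-mono ∈-elements⁻ btw′))))

-- Extremal cardinalities and maxima over all subsets.

∈-allSubsets : (X : Subset n) → X ∈ˡ allSubsets n
∈-allSubsets []          = here refl
∈-allSubsets (false ∷ X) = ∈-++⁺ˡ (∈-map⁺ _ (∈-allSubsets X))
∈-allSubsets {suc n} (true ∷ X) =
  ∈-++⁺ʳ (map (outside ∷_) (allSubsets n)) (∈-map⁺ _ (∈-allSubsets X))

feasibleSets : SetSystem n → List (Subset n)
feasibleSets {n} D = filter (feasible? D) (allSubsets n)

∈-feasibleSets : (D : SetSystem n) → Feasible D X → X ∈ˡ feasibleSets D
∈-feasibleSets D = ∈-filter⁺ (feasible? D) (∈-allSubsets _)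

∣feasible∣≤rmax : (D : SetSystem n) → Feasible D X → ∣ X ∣ ≤ rmax D
∣feasible∣≤rmax D X∈D =
  All.lookup (xs≤max 0 (cardinalities D)) (∈-map⁺ ∣_∣ (∈-feasibleSets D X∈D))

rmin≤∣feasible∣ : (D : SetSystem n) → Feasible D X → rmin D ≤ ∣ X ∣
rmin≤∣feasible∣ {n} D X∈D =
  All.lookup (min≤xs n (cardinalities D)) (∈-map⁺ ∣_∣ (∈-feasibleSets D X∈D))

rmax≤ : ∀ (D : SetSystem n) {m} → (∀ {X} → Feasible D X → ∣ X ∣ ≤ m) → rmax D ≤ m
rmax≤ {n} D bound = max≤v⁺ z≤n (map⁺ (All.map bound (all-filter (feasible? D) (allSubsets n))))

largest : (D : SetSystem n) → Proper D →
  ∃ λ M → Feasible D M × (∀ {X} → Feasible D X → ∣ X ∣ ≤ ∣ M ∣)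
-- The given `F` is the default of `argmax`; as it is feasible, so is the result.
largest {n} D (F , F∈D) = argmax ∣_∣ F (feasibleSets D)
  , argmax-all ∣_∣ F∈D (all-filter (feasible? D) (allSubsets n))
  , λ X∈D → All.lookup (f[xs]≤f[argmax] F (feasibleSets D)) (∈-feasibleSets D X∈D)

smallest : (D : SetSystem n) → Proper D →
  ∃ λ M → Feasible D M × (∀ {X} → Feasible D X → ∣ M ∣ ≤ ∣ X ∣)
smallest {n} D (F , F∈D) = argmin ∣_∣ F (feasibleSets D)
  , argmin-all ∣_∣ F∈D (all-filter (feasible? D) (allSubsets n))
  , λ X∈D → All.lookup (f[argmin]≤f[xs] F (feasibleSets D)) (∈-feasibleSets D X∈D)

maxSubsets-attained : (f : Subset n → ℕ) (F : Subset n) →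
  (∀ B → f B ≤ f F) → f F ≡ maxSubsets f
maxSubsets-attained {n} f F f≤fF = ≤-antisym
  (All.lookup (xs≤max 0 (map f (allSubsets n))) (∈-map⁺ f (∈-allSubsets F)))
  (max≤v⁺ z≤n (map⁺ (All.universal f≤fF (allSubsets n))))

theorem3p3 : (n : ℕ) (D : SetSystem n) → Proper D →
    ∃ λ (F : Subset n) →
    Feasible D F × ω (D *×*∣ F) ≡ maxSubsets (λ B → ω (D *×*∣ B))
theorem3p3 n D proper with largest D proper | smallest D proper
... | M , M∈D , ≤∣M∣ | F , F∈D , ∣F∣≤ =
  F , F∈D , maxSubsets-attained (λ B → ω (D *×*∣ B)) F ω≤ωF
  where
  -- For `X` empty the interval leaves only feasible subsets of `F`, and minimality of `∣ F ∣` makes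
  -- them equal to `F`.
  ∅∈D*×*F : Feasible (D *×*∣ F) ⊥
  ∅∈D*×*F = *×*∣-feasible⁺ {D = D} F∈D (⊥⊆ , inj₂) λ Z∈D (_ , Z⊆F) →
    ⊆∧∣∣≥⇒≡ ([ (λ x∈⊥ → contradiction x∈⊥ ∉⊥) , id ]′ ∘ Z⊆F) (∣F∣≤ Z∈D)

  -- Any other candidate would be a feasible proper superset of `M`.
  M∈D*×*F : Feasible (D *×*∣ F) M
  M∈D*×*F = *×*∣-feasible⁺ {D = D} M∈D (id , inj₁) λ Z∈D (M⊆Z , _) →
    sym (⊆∧∣∣≥⇒≡ M⊆Z (≤∣M∣ Z∈D))

  rmax≤∣M∣ : ∀ B → rmax (D *×*∣ B) ≤ ∣ M ∣
  rmax≤∣M∣ B = rmax≤ (D *×*∣ B) λ X∈D′ →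
    let Z , Z∈D , X⊆Z = *×*∣-feasible⁻ {D = D} X∈D′ in
    ≤-trans (p⊆q⇒∣p∣≤∣q∣ X⊆Z) (≤∣M∣ Z∈D)

  rmin≤0 : rmin (D *×*∣ F) ≤ 0
  rmin≤0 = ≤-trans (rmin≤∣feasible∣ (D *×*∣ F) ∅∈D*×*F) (≤-reflexive (∣⊥∣≡0 n))

  ω≤ωF : ∀ B → ω (D *×*∣ B) ≤ ω (D *×*∣ F)
  ω≤ωF B = begin
    ω (D *×*∣ B)    ≤⟨ m∸n≤m _ (rmin (D *×*∣ B)) ⟩
    rmax (D *×*∣ B) ≤⟨ rmax≤∣M∣ B ⟩
    -- `∣ M ∣` is read as `∣ M ∣ ∸ 0`.
    ∣ M ∣           ≤⟨ ∸-mono (∣feasible∣≤rmax (D *×*∣ F) M∈D*×*F) rmin≤0 ⟩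
    ω (D *×*∣ F)    ∎
    where open ≤-Reasoning
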